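{- There are $F$ and $G$ such that the following hold. (1) $F$ is an interpretation of $\mathbf K^+$ into $\mathbf K^*$: for every $A\in\mathbf K^*$ there is a $\tau^+$-structure $F(A)\in\mathbf K^+$ definable without parameters in $A$ (uniformly in $A$). (2) $G$ is an interpretation of $\mathbf K^*$ into $\mathbf K^+$: for every $B\in\mathbf K^+$ there is a $\tau$-structure $G(B)\in\mathbf K^*$ definable without parameters in $B$ (uniformly in $B$). (3) For every $A\in\mathbf K^*$, $G(F(A))$ is definably isomorphic to $A$, and for every $B\in\mathbf K^+$, $F(G(B))$ is definably isomorphic to $B$. Thus $F$ and $G$ give a bi-interpretation between $\mathbf K^*$ and $\mathbf K^+$.
   Context: One-sorted linear spaces: $\tau$ has a single ternary relation symbol $R$; $\mathbf K^*$ is the class of $\tau$-structures in which $R$ holds only of triples of pairwise distinct elements, $R$ is invariant under permutations of its arguments, and $R(x,y,z)\wedge R(x,y,w)\wedge z\ne w\rightarrow R(x,w,z)$. Two-sorted linear spaces: $\tau^+$ has unary predicates $P$ (points) and $L$ (lines), which are the two sorts, and a binary relation $I$ (incidence, between points and lines); $\mathbf K^+$ is the class of $\tau^+$-structures such that (A) any two distinct points lie on exactly one line and (B) each line contains at least two points. Empty structures are allowed. "Definable without parameters in $A$" is meant in the sense of (possibly multi-dimensional) interpretations: the universe and relations of the defined structure are given, by formulas without parameters, as a definable subset of a finite Cartesian power of $A$ (or a finite disjoint union of such) modulo a definable equivalence relation, with definable relations. -}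

module Defs where

open import Level using (Level; suc)
open import Data.Nat.Base using (ℕ; _+_)
open import Data.Fin.Base using (Fin)
open import Data.Vec.Base using (Vec; []; _∷_; _++_; lookup; map; sum)
open import Data.Vec.Relation.Binary.Pointwise.Inductive using (Pointwise)
open import Data.Product using (_×_; Σ-syntax; ∃₂; ∃!)
open import Data.Sum.Base using (_⊎_)
open import Function.Bundles using (Bijection; _⇔_)
open import Relation.Binary.Bundles using (Setoid)
open import Relation.Binary.Core using (Rel)
open import Relation.Binary.Structures using (IsEquivalence)
open import Relation.Nullary.Negation.Core using (¬_)

private
  variable
    ℓ : Level
    n : ℕ

------------------------------------------------------------------------
-- First-order logic over relational signatures

record Signature : Set₁ where
  field
    Symbol : Set
    arity  : Symbol → ℕ

open Signature public

-- A structure carries its own equality, so that quotients by definable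
-- equivalence relations can be formed.  Empty carriers are allowed.

record Structure (σ : Signature) (ℓ : Level) : Set (suc ℓ) where
  infix 4 _≈_
  field
    Carrier       : Set ℓ
    _≈_           : Rel Carrier ℓ
    isEquivalence : IsEquivalence _≈_
    rel           : (r : Symbol σ) → Vec Carrier (arity σ r) → Set ℓ
    rel-resp      : ∀ r {xs ys} → Pointwise _≈_ xs ys → rel r xs → rel r ys

  setoid : Setoid ℓ ℓ
  setoid = record { isEquivalence = isEquivalence }

-- Formula σ n: formulas with free variables among n de Bruijn indices;
-- a quantifier binds index zero.

infix  8 _≐_
infixr 6 _∧′_
infixr 5 _∨′_
infixr 4 _⇒′_

data Formula (σ : Signature) (n : ℕ) : Set where
  _≐_            : Fin n → Fin n → Formula σ n
  atom           : (r : Symbol σ) → Vec (Fin n) (arity σ r) → Formula σ n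
  ¬′_            : Formula σ n → Formula σ n
  _∧′_ _∨′_ _⇒′_ : Formula σ n → Formula σ n → Formula σ n
  ∀′_ ∃′_        : Formula σ (ℕ.suc n) → Formula σ n

infix 3 _⊨_[_]

_⊨_[_] : ∀ {σ} (A : Structure σ ℓ) → Formula σ n →
         Vec (Structure.Carrier A) n → Set ℓ
A ⊨ x ≐ y     [ ρ ] = Structure._≈_ A (lookup ρ x) (lookup ρ y)
A ⊨ atom r xs [ ρ ] = Structure.rel A r (map (lookup ρ) xs)
A ⊨ ¬′ φ      [ ρ ] = ¬ (A ⊨ φ [ ρ ])
A ⊨ φ ∧′ ψ    [ ρ ] = (A ⊨ φ [ ρ ]) × (A ⊨ ψ [ ρ ])
A ⊨ φ ∨′ ψ    [ ρ ] = (A ⊨ φ [ ρ ]) ⊎ (A ⊨ ψ [ ρ ])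
A ⊨ φ ⇒′ ψ    [ ρ ] = (A ⊨ φ [ ρ ]) → (A ⊨ ψ [ ρ ])
A ⊨ ∀′ φ      [ ρ ] = (a : Structure.Carrier A) → A ⊨ φ [ a ∷ ρ ]
A ⊨ ∃′ φ      [ ρ ] = Σ[ a ∈ Structure.Carrier A ] (A ⊨ φ [ a ∷ ρ ])

Class : Signature → (ℓ : Level) → Set (suc ℓ)
Class σ ℓ = Structure σ ℓ → Set ℓ

record _≅_ {σ} (A B : Structure σ ℓ) : Set ℓ where
  private
    module A = Structure A
    module B = Structure B
  field
    bijection : Bijection A.setoid B.setoid
  open Bijection bijection public using (to)
  field
    rel⇔ : ∀ r (xs : Vec A.Carrier (arity σ r)) →
           A.rel r xs ⇔ B.rel r (map to xs)

------------------------------------------------------------------------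
-- Interpretations

-- Parameter-free formulas that define, in a σ-structure A, a τ-structure
-- whose universe is the disjoint union over i : Fin pieces of the subsets
-- of A^(dim i) defined by dom i, modulo the relation defined by the
-- formulas eq i j.  Each τ-relation is given by one formula for every
-- choice of the pieces that its arguments come from.

record Interpretation (σ τ : Signature) : Set where
  field
    pieces : ℕ
    dim    : Fin pieces → ℕ
    dom    : ∀ i → Formula σ (dim i)
    eq     : ∀ i j → Formula σ (dim i + dim j)
    rel    : ∀ r (is : Vec (Fin pieces) (arity τ r)) →
             Formula σ (sum (map dim is))

module _ {σ τ} (F : Interpretation σ τ) (A : Structure σ ℓ) where
  private
    module F = Interpretation F
    module A = Structure A

  record Element : Set ℓ where
    constructor element
    field
      piece    : Fin F.pieces
      tuple    : Vec A.Carrier (F.dim piece)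
      inDomain : A ⊨ F.dom piece [ tuple ]

  open Element

  flatten : (xs : Vec Element n) →
            Vec A.Carrier (sum (map F.dim (map piece xs)))
  flatten []       = []
  flatten (x ∷ xs) = tuple x ++ flatten xs

  Eq : Rel Element ℓ
  Eq x y = A ⊨ F.eq (piece x) (piece y) [ tuple x ++ tuple y ]

  Holds : (r : Symbol τ) → Vec Element (arity τ r) → Set ℓ
  Holds r xs = A ⊨ F.rel r (map piece xs) [ flatten xs ]

  record Admissible : Set ℓ where
    field
      isEquivalence : IsEquivalence Eq
      rel-resp      : ∀ r {xs ys} → Pointwise Eq xs ys →
                      Holds r xs → Holds r ys

  interpreted : Admissible → Structure τ ℓ
  interpreted adm = record
    { Carrier       = Element
    ; _≈_           = Eq
    ; isEquivalence = Admissible.isEquivalence adm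
    ; rel           = Holds
    ; rel-resp      = Admissible.rel-resp adm
    }

-- An interpretation of the class 𝐋 into the class 𝐊: the same formulas
-- define, in every A in 𝐊, a structure belonging to 𝐋.

record InterpretationOf_Into_ {σ τ} (𝐋 : Class τ ℓ) (𝐊 : Class σ ℓ) :
                              Set (suc ℓ) where
  field
    formulas   : Interpretation σ τ
    admissible : ∀ A → 𝐊 A → Admissible formulas A

  apply : ∀ A → 𝐊 A → Structure τ ℓ
  apply A k = interpreted formulas A (admissible A k)

  field
    inClass : ∀ A (k : 𝐊 A) → 𝐋 (apply A k)

  open Interpretation formulas public using (pieces; dim)

-- For every A in 𝐊, an isomorphism G (F A) ≅ A whose graph is defined in
-- A by formulas that do not depend on A.  An element of G (F A) is a tuple
-- of elements of F A, hence a tuple of tuples of A; there is one formula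
-- for each choice i of the outer piece and js of the inner pieces, and its
-- last variable stands for the image.

module _ {σ τ} {𝐊 : Class σ ℓ} {𝐋 : Class τ ℓ}
         (F : InterpretationOf 𝐋 Into 𝐊) (G : InterpretationOf 𝐊 Into 𝐋) where
  private
    module F = InterpretationOf_Into_ F
    module G = InterpretationOf_Into_ G

  roundTrip : ∀ A → 𝐊 A → Structure σ ℓ
  roundTrip A k = G.apply (F.apply A k) (F.inClass A k)

  GraphFormulas : Set
  GraphFormulas = (i : Fin G.pieces) (js : Vec (Fin F.pieces) (G.dim i)) →
                  Formula σ (sum (map F.dim js) + 1)

  DefinesGraph : GraphFormulas → ∀ A (k : 𝐊 A) → roundTrip A k ≅ A → Set ℓ
  DefinesGraph θ A k f =
    (x : Structure.Carrier (roundTrip A k)) (a : Structure.Carrier A) →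
    let open Element x in
    (A ⊨ θ piece (map Element.piece tuple)
         [ flatten F.formulas A tuple ++ (a ∷ []) ])
      ⇔ Structure._≈_ A (_≅_.to f x) a

  RoundTripDefinablyIsomorphic : Set (suc ℓ)
  RoundTripDefinablyIsomorphic =
    Σ[ θ ∈ GraphFormulas ]
    (∀ A (k : 𝐊 A) → Σ[ f ∈ (roundTrip A k ≅ A) ] DefinesGraph θ A k f)

------------------------------------------------------------------------
-- One-sorted linear spaces

data Symbolτ : Set where
  R : Symbolτ

τ : Signature
τ = record { Symbol = Symbolτ ; arity = λ { R → 3 } }

record 𝐊* (A : Structure τ ℓ) : Set ℓ where
  open Structure A

  Col : Carrier → Carrier → Carrier → Set _
  Col x y z = rel R (x ∷ y ∷ z ∷ [])

  field
    distinct  : ∀ {x y z} → Col x y z → ¬ x ≈ y × ¬ x ≈ z × ¬ y ≈ z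
    symmetric : ∀ {x y z} → Col x y z →
                Col x z y × Col y x z × Col y z x × Col z x y × Col z y x
    exchange  : ∀ {x y z w} → Col x y z → Col x y w → ¬ z ≈ w → Col x w z

------------------------------------------------------------------------
-- Two-sorted linear spaces

data Symbolτ⁺ : Set where
  P L I : Symbolτ⁺

τ⁺ : Signature
τ⁺ = record { Symbol = Symbolτ⁺ ; arity = λ { P → 1 ; L → 1 ; I → 2 } }

record 𝐊⁺ (B : Structure τ⁺ ℓ) : Set ℓ where
  open Structure B

  Point : Carrier → Set _
  Point x = rel P (x ∷ [])

  Line : Carrier → Set _
  Line x = rel L (x ∷ [])

  _on_ : Carrier → Carrier → Set _
  p on l = rel I (p ∷ l ∷ [])

  field
    -- the two sorts, made explicit over a single carrier
    sorted    : ∀ x → Point x ⊎ Line x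
    disjoint  : ∀ x → ¬ (Point x × Line x)
    incidence : ∀ {p l} → p on l → Point p × Line l
    joining   : ∀ {p q} → Point p → Point q → ¬ p ≈ q →
                ∃! _≈_ λ l → Line l × p on l × q on l
    twoPoints : ∀ {l} → Line l →
                ∃₂ λ p q → Point p × Point q × ¬ p ≈ q × p on l × q on l

{-# OPTIONS --safe #-}

-- The lines of a one-sorted space are coded by pairs of distinct points:
-- a , b and c , d code the same line when c and d lie on the line through
-- a and b.  Conversely a two-sorted space is sent to its points with
-- collinearity of distinct triples.  The round trip on one-sorted spaces is
-- the identity on points; on two-sorted spaces it sends a point to itself
-- and a pair of distinct points to the line joining them.

module Submission where

open import Defs
open import Level using (Level)
open import Data.Fin.Base using (Fin)
open import Data.Fin.Patterns using (0F; 1F; 2F; 3F)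
open import Data.Nat.Base using (ℕ)
open import Data.Product using (∃!)
open import Data.Product.Base using (_×_; Σ-syntax; _,_; proj₁; proj₂)
open import Data.Sum.Base using (_⊎_; inj₁; inj₂)
open import Data.Vec.Base using ([]; _∷_)
open import Data.Vec.Relation.Binary.Pointwise.Inductive using (Pointwise; []; _∷_)
open import Axiom.ExcludedMiddle using (ExcludedMiddle)
open import Function.Base using (_∘_)
open import Function.Bundles using (_⇔_; mk⇔)
open import Relation.Binary.Structures using (IsEquivalence)
open import Relation.Nullary.Decidable.Core using (yes; no)
open import Relation.Nullary.Negation.Core using (¬_; contradiction)

private
  variable
    ℓ : Level
    n : ℕ
    σ : Signature

-- Quantified, because a formula may have no free variables to refer to; with
-- these quantifiers the meaning is right in the empty structure as well.

⊥′ ⊤′ : Formula σ n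
⊥′ = ∃′ (¬′ (0F ≐ 0F))
⊤′ = ∀′ (0F ≐ 0F)

-- `R` holds only of distinct triples, so `x` and `y` themselves have to be added to the points
-- collinear with them.
on′ : (x y z : Fin n) → Formula τ n
on′ x y z = z ≐ x ∨′ z ≐ y ∨′ atom R (x ∷ y ∷ z ∷ [])

-- Lines of a one-sorted space and the pairs that code them.

module OneSorted (em : ExcludedMiddle ℓ) {A : Structure τ ℓ} (k : 𝐊* A) where

  open Structure A public
  open IsEquivalence isEquivalence public
  open 𝐊* k public

  On : Carrier → Carrier → Carrier → Set ℓ
  On x y z = z ≈ x ⊎ z ≈ y ⊎ Col x y z

  Col-resp : ∀ {x x′ y y′ z z′} → x ≈ x′ → y ≈ y′ → z ≈ z′ →
             Col x y z → Col x′ y′ z′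
  Col-resp p q r = rel-resp R (p ∷ q ∷ r ∷ [])

  On-resp : ∀ {x x′ y y′ z z′} → x ≈ x′ → y ≈ y′ → z ≈ z′ →
            On x y z → On x′ y′ z′
  On-resp p q r (inj₁ e)        = inj₁ (trans (sym r) (trans e p))
  On-resp p q r (inj₂ (inj₁ e)) = inj₂ (inj₁ (trans (sym r) (trans e q)))
  On-resp p q r (inj₂ (inj₂ c)) = inj₂ (inj₂ (Col-resp p q r c))

  On-left : ∀ {x y} → On x y x
  On-left = inj₁ refl

  On-right : ∀ {x y} → On x y y
  On-right = inj₂ (inj₁ refl)

  On-swap : ∀ {x y z} → On x y z → On y x z
  On-swap (inj₁ e)        = inj₂ (inj₁ e)
  On-swap (inj₂ (inj₁ e)) = inj₁ e
  On-swap (inj₂ (inj₂ c)) = inj₂ (inj₂ (proj₁ (proj₂ (symmetric c))))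

  -- The substance is the case where `c` and `e` are both third points collinear with `a` and `b`.
  -- Excluded middle decides whether they coincide, and if not, `exchange` applies.
  On-replace : ∀ {a b c e} → ¬ a ≈ c → On a b c → On a b e → On a c e
  On-replace a≉c (inj₁ c≈a) _ = contradiction (sym c≈a) a≉c
  On-replace a≉c (inj₂ (inj₁ c≈b)) e∈ab = On-resp refl (sym c≈b) refl e∈ab
  On-replace a≉c (inj₂ (inj₂ abc)) (inj₁ e≈a) = inj₁ e≈a
  On-replace a≉c (inj₂ (inj₂ abc)) (inj₂ (inj₁ e≈b)) =
    inj₂ (inj₂ (Col-resp refl refl (sym e≈b) (proj₁ (symmetric abc))))
  On-replace {c = c} {e} a≉c (inj₂ (inj₂ abc)) (inj₂ (inj₂ abe))
    with em {c ≈ e}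
  ... | yes c≈e = inj₂ (inj₁ (sym c≈e))
  ... | no  c≉e = inj₂ (inj₂ (proj₁ (symmetric (exchange abc abe c≉e))))

  -- A line is determined by any two of its points: replace `b` by `c`, swap, then replace `a` by
  -- `d`. If `a` is already `c`, replacing `b` by `d` is enough.
  On-transfer : ∀ {a b c d e} → ¬ c ≈ d →
                On a b c → On a b d → On a b e → On c d e
  On-transfer {a} {c = c} c≉d c∈ab d∈ab e∈ab with em {a ≈ c}
  ... | yes a≈c = On-resp a≈c refl refl
                    (On-replace (c≉d ∘ trans (sym a≈c)) d∈ab e∈ab)
  ... | no  a≉c = On-replace c≉d
                    (On-swap (On-replace a≉c c∈ab d∈ab))
                    (On-swap (On-replace a≉c c∈ab e∈ab))

  On⇒Col : ∀ {x y z} → ¬ x ≈ z → ¬ y ≈ z → On x y z → Col x y z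
  On⇒Col x≉z y≉z (inj₁ e)        = contradiction (sym e) x≉z
  On⇒Col x≉z y≉z (inj₂ (inj₁ e)) = contradiction (sym e) y≉z
  On⇒Col x≉z y≉z (inj₂ (inj₂ c)) = c

  -- Only one direction is asked for. On pairs with distinct entries this is already an equivalence
  -- relation, by `On-transfer`.
  SameLine : (a b c d : Carrier) → Set ℓ
  SameLine a b c d = On a b c × On a b d

  SameLine-sym : ∀ {a b c d} → ¬ c ≈ d → SameLine a b c d → SameLine c d a b
  SameLine-sym c≉d (c∈ , d∈) =
    On-transfer c≉d c∈ d∈ On-left , On-transfer c≉d c∈ d∈ On-right

  -- By symmetry `a` and `b` lie on the line of `c` and `d`, so the points `e` and `f` of that line
  -- transfer to the line of `a` and `b`.
  SameLine-trans : ∀ {a b c d e f} → ¬ a ≈ b → ¬ c ≈ d →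
                   SameLine a b c d → SameLine c d e f → SameLine a b e f
  SameLine-trans a≉b c≉d s (e∈ , f∈) with SameLine-sym c≉d s
  ... | a∈ , b∈ = On-transfer a≉b a∈ b∈ e∈ , On-transfer a≉b a∈ b∈ f∈

-- Joining lines and collinearity in a two-sorted space.

module TwoSorted (em : ExcludedMiddle ℓ) {B : Structure τ⁺ ℓ} (k : 𝐊⁺ B) where

  open Structure B public
  open IsEquivalence isEquivalence public
  open 𝐊⁺ k public

  Point-resp : ∀ {p q} → p ≈ q → Point p → Point q
  Point-resp e = rel-resp P (e ∷ [])

  on-resp : ∀ {p q l m} → p ≈ q → l ≈ m → p on l → q on m
  on-resp e f = rel-resp I (e ∷ f ∷ [])

  -- This is literally what the formula for `R` in `pointsFormulas` evaluates to. Hence `On` below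
  -- agrees definitionally with `on′` in the space of points, and the second round trip needs no
  -- translation.
  Collinear : Carrier → Carrier → Carrier → Set ℓ
  Collinear x y z = ¬ x ≈ y × ¬ x ≈ z × ¬ y ≈ z ×
                    (Σ[ l ∈ Carrier ] x on l × y on l × z on l)

  -- Incidence supplies the sorts, and both lines equal the one given by `joining`.
  line-unique : ∀ {p q l m} → ¬ p ≈ q → p on l → q on l → p on m → q on m →
                l ≈ m
  line-unique p≉q pl ql pm qm
    with joining (proj₁ (incidence pl)) (proj₁ (incidence ql)) p≉q
  ... | _ , _ , unique =
    trans (sym (unique (proj₂ (incidence pl) , pl , ql)))
          (unique (proj₂ (incidence pm) , pm , qm))

  join : ∀ {p q} → Point p → Point q → ¬ p ≈ q → Carrier
  join pp qp p≉q = proj₁ (joining pp qp p≉q)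

  module _ {p q} (pp : Point p) (qp : Point q) (p≉q : ¬ p ≈ q) where

    join-line : Line (join pp qp p≉q)
    join-line = proj₁ (proj₁ (proj₂ (joining pp qp p≉q)))

    join-left : p on join pp qp p≉q
    join-left = proj₁ (proj₂ (proj₁ (proj₂ (joining pp qp p≉q))))

    join-right : q on join pp qp p≉q
    join-right = proj₂ (proj₂ (proj₁ (proj₂ (joining pp qp p≉q))))

    join-unique : ∀ {l} → p on l → q on l → join pp qp p≉q ≈ l
    join-unique = line-unique p≉q join-left join-right

  On : Carrier → Carrier → Carrier → Set ℓ
  On x y z = z ≈ x ⊎ z ≈ y ⊎ Collinear x y z

  module _ {p q l} (p≉q : ¬ p ≈ q) (pl : p on l) (ql : q on l) where

    On⇒on : ∀ {r} → On p q r → r on l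
    On⇒on (inj₁ e)        = on-resp (sym e) refl pl
    On⇒on (inj₂ (inj₁ e)) = on-resp (sym e) refl ql
    On⇒on (inj₂ (inj₂ (_ , _ , _ , _ , pm , qm , rm))) =
      -- The line witnessing collinearity shares `p` and `q` with `l`, so it is `l`.
      on-resp refl (line-unique p≉q pm qm pl ql) rm

    on⇒On : ∀ {r} → r on l → On p q r
    -- `Collinear` demands distinctness, so coincidence of `r` with `p` or `q` must be decided
    -- first.
    on⇒On {r} rl with em {r ≈ p} | em {r ≈ q}
    ... | yes e | _     = inj₁ e
    ... | no _  | yes e = inj₂ (inj₁ e)
    ... | no r≉p | no r≉q =
      inj₂ (inj₂ (p≉q , r≉p ∘ sym , r≉q ∘ sym , l , pl , ql , rl))

-- The defining formulas in both directions.

pattern point a d  = element 0F (a ∷ []) d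
pattern line a b d = element 1F (a ∷ b ∷ []) d

linesFormulas : Interpretation τ τ⁺
linesFormulas = record
  { pieces = 2
  ; dim    = λ { 0F → 1 ; 1F → 2 }
  ; dom    = λ { 0F → ⊤′ ; 1F → ¬′ (0F ≐ 1F) }
  ; eq     = λ { 0F 0F → 0F ≐ 1F
               ; 0F 1F → ⊥′
               ; 1F 0F → ⊥′
               ; 1F 1F → on′ 0F 1F 2F ∧′ on′ 0F 1F 3F
               }
  ; rel    = λ { P (0F ∷ []) → ⊤′
               ; P (1F ∷ []) → ⊥′
               ; L (0F ∷ []) → ⊥′
               ; L (1F ∷ []) → ⊤′
               ; I (0F ∷ 0F ∷ []) → ⊥′
               -- `flatten` puts the point first, so the pair coding the line is `1F`, `2F`.
               ; I (0F ∷ 1F ∷ []) → on′ 1F 2F 0F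
               ; I (1F ∷ _ ∷ [])  → ⊥′
               }
  }

pointsFormulas : Interpretation τ⁺ τ
pointsFormulas = record
  { pieces = 1
  ; dim    = λ _ → 1
  ; dom    = λ _ → atom P (0F ∷ [])
  ; eq     = λ _ _ → 0F ≐ 1F
  ; rel    = λ { R (_ ∷ _ ∷ _ ∷ []) →
                 ¬′ (0F ≐ 1F) ∧′ ¬′ (0F ≐ 2F) ∧′ ¬′ (1F ≐ 2F) ∧′
                 ∃′ (atom I (1F ∷ 0F ∷ []) ∧′ atom I (2F ∷ 0F ∷ []) ∧′
                     atom I (3F ∷ 0F ∷ [])) }
  }

-- The two-sorted space defined in a one-sorted space.

module LinesOf (em : ExcludedMiddle ℓ) {A : Structure τ ℓ} (k : 𝐊* A) where

  open OneSorted em k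

  Elem : Set ℓ
  Elem = Element linesFormulas A

  infix 4 _≃_
  _≃_ : Elem → Elem → Set ℓ
  _≃_ = Eq linesFormulas A

  -- `⊥′` evaluates to this hypothesis rather than to the empty type, so cases of mismatched sorts
  -- are closed by hand with it.
  absurd : ∀ {x} {X : Set x} → (Σ[ a ∈ Carrier ] ¬ a ≈ a) → X
  absurd (_ , a≉a) = contradiction refl a≉a

  ≃-refl : ∀ x → x ≃ x
  ≃-refl (point a _)  = refl
  ≃-refl (line a b _) = On-left , On-right

  ≃-sym : ∀ x y → x ≃ y → y ≃ x
  ≃-sym (point _ _) (point _ _)      e = sym e
  ≃-sym (point _ _) (line _ _ _)     e = absurd e
  ≃-sym (line _ _ _) (point _ _)     e = absurd e
  ≃-sym (line _ _ _) (line _ _ c≉d)  e = SameLine-sym c≉d e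

  ≃-trans : ∀ x y z → x ≃ y → y ≃ z → x ≃ z
  ≃-trans (point _ _) (point _ _) (point _ _) e f = trans e f
  ≃-trans (line _ _ a≉b) (line _ _ c≉d) (line _ _ _) e f =
    SameLine-trans a≉b c≉d e f
  ≃-trans (point _ _) (line _ _ _) _ e _ = absurd e
  ≃-trans (line _ _ _) (point _ _) _ e _ = absurd e
  ≃-trans (point _ _) (point _ _) (line _ _ _) _ f = absurd f
  ≃-trans (line _ _ _) (line _ _ _) (point _ _) _ f = absurd f

  admissible : Admissible linesFormulas A
  admissible = record
    { isEquivalence = record
      { refl  = λ {x} → ≃-refl x
      ; sym   = λ {x} {y} → ≃-sym x y
      ; trans = λ {x} {y} {z} → ≃-trans x y z
      }
    ; rel-resp = resp
    }
    where
    resp : ∀ r {xs ys} → Pointwise _≃_ xs ys →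
           Holds linesFormulas A r xs → Holds linesFormulas A r ys
    resp P {point _ _ ∷ []}  {point _ _ ∷ []}  _ h = h
    resp P {point _ _ ∷ []}  {line _ _ _ ∷ []} (e ∷ []) _ = absurd e
    resp P {line _ _ _ ∷ []} _ h = absurd h
    resp L {line _ _ _ ∷ []} {line _ _ _ ∷ []} _ h = h
    resp L {line _ _ _ ∷ []} {point _ _ ∷ []}  (e ∷ []) _ = absurd e
    resp L {point _ _ ∷ []}  _ h = absurd h
    resp I {point _ _ ∷ line _ _ _ ∷ []} {point _ _ ∷ line _ _ c≉d ∷ []}
         (e ∷ (c∈ , d∈) ∷ []) h =
      On-resp refl refl e (On-transfer c≉d c∈ d∈ h)
    resp I {point _ _ ∷ line _ _ _ ∷ []} {point _ _ ∷ point _ _ ∷ []}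
         (_ ∷ e ∷ []) _ = absurd e
    resp I {point _ _ ∷ line _ _ _ ∷ []} {line _ _ _ ∷ _ ∷ []}
         (e ∷ _) _ = absurd e
    resp I {point _ _ ∷ point _ _ ∷ []} _ h = absurd h
    resp I {line _ _ _ ∷ _ ∷ []} _ h = absurd h

  structure : Structure τ⁺ ℓ
  structure = interpreted linesFormulas A admissible

  point! : Carrier → Elem
  point! a = point a (λ _ → refl)

  inClass : 𝐊⁺ structure
  inClass = record
    { sorted    = λ { (point _ _) → inj₁ λ _ → refl
                    ; (line _ _ _) → inj₂ λ _ → refl }
    ; disjoint  = λ { (point _ _) (_ , l) → absurd l
                    ; (line _ _ _) (p , _) → absurd p }
    ; incidence = λ { {point _ _} {line _ _ _} _ → (λ _ → refl) , (λ _ → refl)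
                    ; {point _ _} {point _ _} h → absurd h
                    ; {line _ _ _} h → absurd h }
    ; joining   = λ {p} {q} → joins p q
    ; twoPoints = λ { {line a b a≉b} _ →
                        point! a , point! b , (λ _ → refl) , (λ _ → refl) ,
                        a≉b , On-left , On-right
                    ; {point _ _} h → absurd h }
    }
    where
    open Structure structure using () renaming (rel to rel⁺)
    joins : ∀ p q → rel⁺ P (p ∷ []) → rel⁺ P (q ∷ []) → ¬ p ≃ q →
            ∃! _≃_ λ l →
              rel⁺ L (l ∷ []) × rel⁺ I (p ∷ l ∷ []) × rel⁺ I (q ∷ l ∷ [])
    joins (point a _) (point b _) _ _ a≉b =
      line a b a≉b , ((λ _ → refl) , On-left , On-right) ,
      -- Incidence of `a` and `b` with another coded line is exactly `SameLine` from its code to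
      -- `a`, `b`; symmetry turns it into the required equality.
      λ { {line _ _ _} (_ , a∈ , b∈) → SameLine-sym a≉b (a∈ , b∈)
        ; {point _ _} (h , _) → absurd h }
    joins (line _ _ _) _ h _ _ = absurd h
    joins (point _ _) (line _ _ _) _ h _ = absurd h

-- The one-sorted space of points of a two-sorted space.

module PointsOf (em : ExcludedMiddle ℓ) {B : Structure τ⁺ ℓ} (k : 𝐊⁺ B) where

  open TwoSorted em k

  admissible : Admissible pointsFormulas B
  admissible = record
    { isEquivalence = record
      { refl  = λ { {point _ _} → refl }
      ; sym   = λ { {point _ _} {point _ _} e → sym e }
      ; trans = λ { {point _ _} {point _ _} {point _ _} e f → trans e f }
      }
    ; rel-resp = λ { R {point _ _ ∷ point _ _ ∷ point _ _ ∷ []}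
                       {point _ _ ∷ point _ _ ∷ point _ _ ∷ []}
                       (e ∷ f ∷ g ∷ []) (x≉y , x≉z , y≉z , l , xl , yl , zl) →
        x≉y ∘ (λ h → trans e (trans h (sym f))) ,
        x≉z ∘ (λ h → trans e (trans h (sym g))) ,
        y≉z ∘ (λ h → trans f (trans h (sym g))) ,
        l , on-resp e refl xl , on-resp f refl yl , on-resp g refl zl }
    }

  structure : Structure τ ℓ
  structure = interpreted pointsFormulas B admissible

  inClass : 𝐊* structure
  inClass = record
    { distinct  = λ { {point _ _} {point _ _} {point _ _}
                      (x≉y , x≉z , y≉z , _) → x≉y , x≉z , y≉z }
    ; symmetric = λ { {point _ _} {point _ _} {point _ _}
                      (x≉y , x≉z , y≉z , l , xl , yl , zl) →
        (x≉z , x≉y , y≉z ∘ sym , l , xl , zl , yl) ,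
        (x≉y ∘ sym , y≉z , x≉z , l , yl , xl , zl) ,
        (y≉z , x≉y ∘ sym , x≉z ∘ sym , l , yl , zl , xl) ,
        (x≉z ∘ sym , y≉z ∘ sym , x≉y , l , zl , xl , yl) ,
        (y≉z ∘ sym , x≉z ∘ sym , x≉y ∘ sym , l , zl , yl , xl) }
    ; exchange  = λ { {point _ _} {point _ _} {point _ _} {point _ _}
                      (x≉y , x≉z , _ , l , xl , yl , zl)
                      (_ , x≉w , _ , m , xm , ym , wm) z≉w →
        x≉w , x≉z , z≉w ∘ sym ,
        -- The two witnessing lines share the distinct points `x` and `y`, so they coincide and `w`
        -- lies on `l`.
        l , xl , on-resp refl (line-unique x≉y xm ym xl yl) wm , zl }
    }

-- The two interpretations between the classes.

module _ (em : ExcludedMiddle ℓ) where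

  linesInterpretation : InterpretationOf (𝐊⁺ {ℓ}) Into (𝐊* {ℓ})
  linesInterpretation = record
    { formulas   = linesFormulas
    ; admissible = λ _ k → LinesOf.admissible em k
    ; inClass    = λ _ k → LinesOf.inClass em k
    }

  pointsInterpretation : InterpretationOf (𝐊* {ℓ}) Into (𝐊⁺ {ℓ})
  pointsInterpretation = record
    { formulas   = pointsFormulas
    ; admissible = λ _ k → PointsOf.admissible em k
    ; inClass    = λ _ k → PointsOf.inClass em k
    }

  -- The round trip on one-sorted spaces.

  pointsOfLines : RoundTripDefinablyIsomorphic linesInterpretation
                                               pointsInterpretation
  pointsOfLines = graph , λ A k → iso A k , definesGraph A k
    where
    graph : GraphFormulas linesInterpretation pointsInterpretation
    graph _ (0F ∷ []) = 0F ≐ 1F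
    -- A default value: the outer domain requires `P`, which is false of coded lines.
    graph _ (1F ∷ []) = ⊥′

    module _ (A : Structure τ ℓ) (k : 𝐊* A) where
      open OneSorted em k
      open LinesOf em k using (absurd; point!)

      GF : Structure τ ℓ
      GF = roundTrip linesInterpretation pointsInterpretation A k

      module GF = Structure GF

      to : GF.Carrier → Carrier
      to (point (point a _) _)    = a
      to (point (line _ _ _) bad) = absurd bad

      to-cong : ∀ x y → x GF.≈ y → to x ≈ to y
      to-cong (point (point _ _) _) (point (point _ _) _) e = e
      to-cong (point (line _ _ _) bad) _ _ = absurd bad
      to-cong (point (point _ _) _) (point (line _ _ _) bad) _ = absurd bad

      to-injective : ∀ x y → to x ≈ to y → x GF.≈ y
      to-injective (point (point _ _) _) (point (point _ _) _) e = e
      to-injective (point (line _ _ _) bad) _ _ = absurd bad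
      to-injective (point (point _ _) _) (point (line _ _ _) bad) _ = absurd bad

      from : Carrier → GF.Carrier
      from a = point (point! a) (λ _ → refl)

      Col⇔ : ∀ x y z → GF.rel R (x ∷ y ∷ z ∷ []) ⇔ Col (to x) (to y) (to z)
      Col⇔ (point (line _ _ _) bad) _ _ = absurd bad
      Col⇔ (point (point _ _) _) (point (line _ _ _) bad) _ = absurd bad
      Col⇔ (point (point _ _) _) (point (point _ _) _)
           (point (line _ _ _) bad) = absurd bad
      Col⇔ (point (point x _) _) (point (point y _) _) (point (point z _) _) =
        mk⇔ (λ { (x≉y , x≉z , y≉z , line _ _ _ , x∈ , y∈ , z∈) →
                 -- The three points lie on one coded line; it is recoded by `x` and `y`, and
                 -- distinctness leaves only genuine collinearity.
                 On⇒Col x≉z y≉z (On-transfer x≉y x∈ y∈ z∈)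
               ; (_ , _ , _ , point _ _ , bad , _) → absurd bad })
            (λ xyz → let x≉y , x≉z , y≉z = distinct xyz in
               x≉y , x≉z , y≉z ,
               line x y x≉y , On-left , On-right , inj₂ (inj₂ xyz))

      iso : GF ≅ A
      iso = record
        { bijection = record
          { to = to
          ; cong = λ {x} {y} → to-cong x y
          ; bijective = (λ {x} {y} → to-injective x y) ,
                        -- `to (from a)` computes to `a`, so congruence alone gives surjectivity.
                        λ a → from a , λ {z} → to-cong z (from a)
          }
        ; rel⇔ = λ { R (x ∷ y ∷ z ∷ []) → Col⇔ x y z }
        }

      definesGraph : DefinesGraph linesInterpretation pointsInterpretation
                                  graph A k iso
      definesGraph (point (point _ _) _)    _ = mk⇔ (λ e → e) (λ e → e)
      definesGraph (point (line _ _ _) bad) _ = absurd bad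

  -- The round trip on two-sorted spaces.

  linesOfPoints : RoundTripDefinablyIsomorphic pointsInterpretation
                                               linesInterpretation
  linesOfPoints = graph , λ B k → iso B k , definesGraph B k
    where
    graph : GraphFormulas pointsInterpretation linesInterpretation
    graph 0F (_ ∷ [])     = 0F ≐ 1F
    -- The coding points are distinct, so these two incidences single out their joining line.
    graph 1F (_ ∷ _ ∷ []) = atom I (0F ∷ 2F ∷ []) ∧′ atom I (1F ∷ 2F ∷ [])

    module _ (B : Structure τ⁺ ℓ) (k : 𝐊⁺ B) where
      open TwoSorted em k
      open LinesOf em (PointsOf.inClass em k) using (absurd)

      FG : Structure τ⁺ ℓ
      FG = roundTrip pointsInterpretation linesInterpretation B k

      module FG = Structure FG

      to : FG.Carrier → Carrier
      to (point (point p _) _)                = p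
      to (line (point _ pp) (point _ qp) p≉q) = join pp qp p≉q

      point≉line : ∀ {p l} → Point p → Line l → ¬ p ≈ l
      point≉line pp ll e = disjoint _ (Point-resp e pp , ll)

      to-cong : ∀ x y → x FG.≈ y → to x ≈ to y
      to-cong (point (point _ _) _) (point (point _ _) _) e = e
      to-cong (line (point _ pp) (point _ qp) p≉q)
              (line (point _ pp′) (point _ qp′) p≉q′) (p′∈ , q′∈) =
        -- The join of `p` and `q` passes through both points of the second pair, hence is their
        -- join.
        sym (join-unique pp′ qp′ p≉q′
              (On⇒on p≉q (join-left pp qp p≉q) (join-right pp qp p≉q) p′∈)
              (On⇒on p≉q (join-left pp qp p≉q) (join-right pp qp p≉q) q′∈))
      to-cong (point _ _) (line _ _ _) bad = absurd bad
      to-cong (line _ _ _) (point _ _) bad = absurd bad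

      to-injective : ∀ x y → to x ≈ to y → x FG.≈ y
      to-injective (point (point _ _) _) (point (point _ _) _) e = e
      to-injective (line (point _ pp) (point _ qp) p≉q)
                   (line (point _ pp′) (point _ qp′) p≉q′) e =
        on⇒On p≉q (join-left pp qp p≉q) (join-right pp qp p≉q)
              (on-resp refl (sym e) (join-left pp′ qp′ p≉q′)) ,
        on⇒On p≉q (join-left pp qp p≉q) (join-right pp qp p≉q)
              (on-resp refl (sym e) (join-right pp′ qp′ p≉q′))
      to-injective (point (point _ pp) _)
                   (line (point _ pp′) (point _ qp′) p≉q′) e =
        contradiction e (point≉line pp (join-line pp′ qp′ p≉q′))
      to-injective (line (point _ pp) (point _ qp) p≉q)
                   (point (point _ pp′) _) e =
        contradiction (sym e) (point≉line pp′ (join-line pp qp p≉q))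

      -- A line is coded by the pair that `twoPoints` happens to supply; any other pair on it would
      -- code an equal element.
      from : Carrier → FG.Carrier
      from b with sorted b
      ... | inj₁ pp = point (point b pp) λ { (point _ _) → refl }
      ... | inj₂ ll with twoPoints ll
      ...   | p , q , pp , qp , p≉q , _ = line (point p pp) (point q qp) p≉q

      to-from : ∀ b → to (from b) ≈ b
      to-from b with sorted b
      ... | inj₁ _ = refl
      ... | inj₂ ll with twoPoints ll
      ...   | _ , _ , pp , qp , p≉q , pl , ql = join-unique pp qp p≉q pl ql

      Point⇔ : ∀ x → FG.rel P (x ∷ []) ⇔ Point (to x)
      Point⇔ (point (point _ pp) _) = mk⇔ (λ _ → pp) (λ { _ (point _ _) → refl })
      Point⇔ (line (point _ pp) (point _ qp) p≉q) =
        mk⇔ absurd (λ h → contradiction (h , join-line pp qp p≉q) (disjoint _))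

      Line⇔ : ∀ x → FG.rel L (x ∷ []) ⇔ Line (to x)
      Line⇔ (point (point _ pp) _) =
        mk⇔ absurd (λ h → contradiction (pp , h) (disjoint _))
      Line⇔ (line (point _ pp) (point _ qp) p≉q) =
        mk⇔ (λ _ → join-line pp qp p≉q) (λ { _ (point _ _) → refl })

      -- For a point and a coded line the left side is `On`, which matches incidence with the
      -- joining line. In the other cases both sides are false, since incidence in `B` fixes the
      -- sorts.
      on⇔ : ∀ x y → FG.rel I (x ∷ y ∷ []) ⇔ to x on to y
      on⇔ (point (point _ pp) _) (line (point _ qp) (point _ rp) q≉r) =
        mk⇔ (On⇒on q≉r (join-left qp rp q≉r) (join-right qp rp q≉r))
            (on⇒On q≉r (join-left qp rp q≉r) (join-right qp rp q≉r))
      on⇔ (point (point _ pp) _) (point (point _ qp) _) =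
        mk⇔ absurd
            (λ h → contradiction (qp , proj₂ (incidence h)) (disjoint _))
      on⇔ (line (point _ pp) (point _ qp) p≉q) _ =
        mk⇔ absurd
            (λ h → contradiction (proj₁ (incidence h) , join-line pp qp p≉q)
                                 (disjoint _))

      iso : FG ≅ B
      iso = record
        { bijection = record
          { to = to
          ; cong = λ {x} {y} → to-cong x y
          ; bijective = (λ {x} {y} → to-injective x y) ,
                        λ b → from b , λ {z} e →
                          trans (to-cong z (from b) e) (to-from b)
          }
        ; rel⇔ = λ { P (x ∷ [])     → Point⇔ x
                   ; L (x ∷ [])     → Line⇔ x
                   ; I (x ∷ y ∷ []) → on⇔ x y }
        }

      definesGraph : DefinesGraph pointsInterpretation linesInterpretation
                                  graph B k iso
      definesGraph (point (point _ _) _) _ = mk⇔ (λ e → e) (λ e → e)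
      definesGraph (line (point _ pp) (point _ qp) p≉q) _ =
        mk⇔ (λ { (pl , ql) → join-unique pp qp p≉q pl ql })
            (λ e → on-resp refl e (join-left pp qp p≉q) ,
                   on-resp refl e (join-right pp qp p≉q))

theorem2p9 : (ℓ : Level) → ExcludedMiddle ℓ →
    Σ[ F ∈ InterpretationOf (𝐊⁺ {ℓ}) Into (𝐊* {ℓ}) ]
    Σ[ G ∈ InterpretationOf (𝐊* {ℓ}) Into (𝐊⁺ {ℓ}) ]
    (RoundTripDefinablyIsomorphic F G × RoundTripDefinablyIsomorphic G F)
theorem2p9 ℓ em =
  linesInterpretation em , pointsInterpretation em ,
  pointsOfLines em , linesOfPoints em
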